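{- Let $p\ge 1$, $q\ge 1$, $m>1$, $n\ge \max\{m,3\}$ be integers, let $S=\{0,1,\ldots,m-1\}$, and let $\varphi:S^p\to S^q$ be a partial function. Then there exists a graph $G_{\varphi,n}[\mathbf{x};\mathbf{y};R]$ that simulates $\varphi$ through $n$-colorings. Moreover, if $\Theta$ denotes the number of transpositions in a presentation of an $(m,p+q,s_0)$-invertible extension of $\varphi$ as a product of transpositions of $S^{p+q}$, then $$|V(G_{\varphi,n})| = O\big(\Theta\,(p+q)\, n^{2(p+q)+4}\big)\quad\text{and}\quad |E(G_{\varphi,n})| = O\big(\Theta\,(p+q)\, n^{3(p+q)+5}\big).$$
   Context: All graphs are finite and simple. Let $S=\{0,\ldots,m-1\}$ (symbols) and $C=\{0,\ldots,n-1\}$ (colors). An $n$-coloring of a graph $G$ is a map $\sigma:V(G)\to C$ with $\sigma(u)\ne\sigma(v)$ for every edge $uv$. A partial function $\varphi:S^p\to S^q$ may be undefined on some elements of $S^p$; its domain is the set of elements at which it is defined. Simulation: a graph $G$ with specified vertices $X=\{x_0,\ldots,x_{p-1}\}$ (inputs), $Y=\{y_0,\ldots,y_{q-1}\}$ (outputs) and $R=\{\tilde 0,\tilde 1,\ldots,\widetilde{n-1}\}$ (references), written $G[\mathbf{x};\mathbf{y};R]$, simulates $\varphi$ through $n$-colorings if: (i) $G$ is $n$-colorable and $X\cup Y\cup R\subseteq V(G)$; (ii) in every $n$-coloring of $G$ the vertices of $R$ take pairwise different colors (so one may normalize to $\sigma(\tilde i)=i$); (iii) every assignment $\sigma_0:X\cup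 R\to C$ with $\sigma_0(\tilde i)=i$ for all $0\le i<n$ has an extension to an $n$-coloring $\sigma$ of $G$ if and only if $(\sigma_0(x_0),\ldots,\sigma_0(x_{p-1}))$ is in the domain of $\varphi$, in which case the extension $\sigma$ is unique and $\varphi(\sigma(x_0),\ldots,\sigma(x_{p-1}))=(\sigma(y_0),\ldots,\sigma(y_{q-1}))$. For $s_0\in S$, an $(m,p+q,s_0)$-invertible extension of $\varphi$ is a bijection $\tilde\varphi:S^{p+q}\to S^{p+q}$ such that for each $\mathbf{x}$ in the domain of $\varphi$ one has $\tilde\varphi(\mathbf{x},s_0,\ldots,s_0)=(\varphi(\mathbf{x}),\mathbf{y}_{\mathbf{x}})$ for some vector $\mathbf{y}_{\mathbf{x}}\in S^{p}$. The implied constants in $O(\cdot)$ are absolute, and $\Theta\ge1$.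
   Formalization: The partial function φ is assumed to be defined on at least one element of S^p; for the nowhere-defined φ the claim fails, since a normalized n-coloring of G would give an extendable assignment whose inputs must lie in the empty domain. -}

module Defs where

open import Level using (0ℓ)
open import Data.Nat using (ℕ; _+_; _≤_)
open import Data.Nat.Properties using (+-comm)
open import Data.Fin using (Fin; inject≤; _<?_)
open import Data.List using (List; length; filter; allFin; cartesianProduct; foldr)
open import Data.Maybe using (Maybe; just)
open import Data.Product using (∃; _×_; _,_)
open import Data.Vec using (Vec; map; _++_; replicate; cast)
open import Data.Vec.Membership.Propositional using (_∉_)
open import Data.Vec.Relation.Unary.Unique.Propositional using (Unique)
open import Function using (id; _∘_; Injective; _⇔_; _⤖_; Bijection)
open import Relation.Binary using (Rel; Decidable; DecidableEquality; Irreflexive; Symmetric)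
open import Relation.Binary.PropositionalEquality using (_≡_; _≢_)
open import Relation.Nullary.Decidable using (yes; no; _×-dec_)

record Graph : Set₁ where
  field
    order : ℕ
  Vertex : Set
  Vertex = Fin order
  field
    _~_      : Rel Vertex 0ℓ
    _~?_     : Decidable _~_
    ~-sym    : Symmetric _~_
    ~-irrefl : Irreflexive _≡_ _~_

  -- Each edge is counted once, through its pair of endpoints u < v.
  size : ℕ
  size = length (filter (λ (u , v) → (u <? v) ×-dec (u ~? v))
                        (cartesianProduct (allFin order) (allFin order)))

  IsColoring : (n : ℕ) → (Vertex → Fin n) → Set
  IsColoring n σ = ∀ {u v} → u ~ v → σ u ≢ σ v

-- Symbols are S = Fin m, and a function undefined at s takes the value nothing.
PartialFunction : (m p q : ℕ) → Set
PartialFunction m p q = Vec (Fin m) p → Maybe (Vec (Fin m) q)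

_∈Dom_ : ∀ {m p q} → Vec (Fin m) p → PartialFunction m p q → Set
s ∈Dom φ = ∃ λ t → φ s ≡ just t

-- The inclusion of Sᵏ in Cᵏ, where C = Fin n.
toColors : ∀ {m n k} → .(m ≤ n) → Vec (Fin m) k → Vec (Fin n) k
toColors m≤n = map (λ s → inject≤ s m≤n)

-- The specified vertices of G[x; y; R].  The inputs are distinct and are not
-- references, so that a map X ∪ R → C sending each reference ref i to i is the
-- same thing as a vector in Cᵖ.  Distinctness of the references is part of
-- Simulates; outputs may coincide with inputs or references.
record Terminals (G : Graph) (p q n : ℕ) : Set where
  open Graph G
  field
    inputs         : Vec Vertex p
    outputs        : Vec Vertex q
    ref            : Fin n → Vertex
    inputs-unique  : Unique inputs
    outputs-unique : Unique outputs
    ref∉inputs     : ∀ i → ref i ∉ inputs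

module _ {G : Graph} {p q n : ℕ} (T : Terminals G p q n) where
  open Graph G
  open Terminals T

  record IsExtension (a : Vec (Fin n) p) (σ : Vertex → Fin n) : Set where
    field
      isColoring : IsColoring n σ
      on-inputs  : map σ inputs ≡ a
      on-refs    : ∀ i → σ (ref i) ≡ i

  record Simulates {m : ℕ} (m≤n : m ≤ n) (φ : PartialFunction m p q) : Set where
    field
      colorable      : ∃ (IsColoring n)
      refs-distinct  : ∀ σ → IsColoring n σ → Injective _≡_ _≡_ (σ ∘ ref)
      extendable     : ∀ a → ∃ (IsExtension a) ⇔
                             (∃ λ s → s ∈Dom φ × toColors m≤n s ≡ a)
      unique         : ∀ a σ τ → IsExtension a σ → IsExtension a τ →
                       ∀ v → σ v ≡ τ v
      outputs-value  : ∀ s t σ → φ s ≡ just t → IsExtension (toColors m≤n s) σ →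
                       map σ outputs ≡ toColors m≤n t

-- The cast only reorders the length q + p of (φ(x), yₓ) into p + q.
IsInvertibleExtension : ∀ {m p q} → PartialFunction m p q → Fin m →
                        Vec (Fin m) (p + q) ⤖ Vec (Fin m) (p + q) → Set
IsInvertibleExtension {m} {p} {q} φ s₀ φ̃ =
  ∀ s t → φ s ≡ just t →
  ∃ λ (r : Vec (Fin m) p) →
    Bijection.to φ̃ (s ++ replicate q s₀) ≡ cast (+-comm q p) (t ++ r)

record Transposition (A : Set) : Set where
  field
    fst snd  : A
    distinct : fst ≢ snd

module _ {A : Set} (_≟_ : DecidableEquality A) where

  swap : Transposition A → A → A
  swap τ a with a ≟ Transposition.fst τ
  ... | yes _ = Transposition.snd τ
  ... | no  _ with a ≟ Transposition.snd τ
  ...   | yes _ = Transposition.fst τ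
  ...   | no  _ = a

  product : List (Transposition A) → A → A
  product = foldr (λ τ f → swap τ ∘ f) id

  _IsPresentationOf_ : List (Transposition A) → (A ⤖ A) → Set
  τs IsPresentationOf f = ∀ a → Bijection.to f a ≡ product τs a

{-# OPTIONS --safe #-}
module Submission where

-- Since Θ ≥ 1, it suffices to find a graph of order O((p + q) n^(p + q + 1)) for
-- every φ, whatever the transpositions; its size is bounded by the square of its
-- order.  Inputs and outputs together form a vector xs ∈ C^(p + q), and the graph
-- has to admit exactly the vectors of the form (s , φ(s)), with the colors of all
-- other vertices forced by xs.  Restricting vertices to palettes by means of the
-- references, one builds vertices that test whether a coordinate of xs has a given
-- color, and for each r ∈ C^(p + q) a chain of conjunctions of such tests which
-- tells whether xs = r.  When r is not of the form (s , φ(s)), the end of the chain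
-- is forbidden to say yes.

open import Defs
open import Data.Bool using (Bool; true; false; _∧_; if_then_else_)
open import Data.Bool.Properties using (∧-assoc; ∧-identityʳ)
open import Data.Empty using (⊥-elim)
open import Data.Maybe using (just)
import Data.Maybe.Properties as Maybe
open import Data.Maybe.Properties using (just-injective)
open import Data.Nat using (ℕ; zero; suc; _+_; _*_; _^_; _⊔_; _≤_; _<_; z≤n; s≤s;
  NonZero; >-nonZero)
open import Data.Nat.Properties
  using (module ≤-Reasoning; m⊔n≤o⇒m≤o; m⊔n≤o⇒n≤o; ≤-trans; _<?_; m≤m+n; m≤m*n; m≤n*m; m^n>0; m^n≢0;
         m*n≢0; +-mono-≤; +-monoʳ-≤; *-mono-≤; *-monoˡ-≤; *-monoʳ-≤; *-identityʳ; ^-monoʳ-≤;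
         ^-distribˡ-+-*)
open import Data.Nat.Tactic.RingSolver using (solve-∀)
open import Data.Fin using (Fin; zero; suc; inject₁; inject≤; fromℕ; fromℕ<; toℕ; _↑ˡ_; _↑ʳ_; _≟_)
open import Data.Fin.Induction using (<-weakInduction)
open import Data.Fin.Patterns using (0F; 1F; 2F)
open import Data.Fin.Properties
  using (+↔⊎; *↔×; inject≤-injective; toℕ-injective; toℕ-inject≤; toℕ-fromℕ<; toℕ<n;
         ↑ˡ-injective; ↑ʳ-injective)
open import Data.List as List using (List; []; _∷_; length; allFin; filter; cartesianProduct)
open import Data.List.Membership.Propositional using (_∈_; _∉_)
open import Data.List.Membership.Propositional.Properties
  using (∈-map⁺; ∈-filter⁺; ∈-++⁺ˡ; ∈-++⁺ʳ; ∈-allFin)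
import Data.List.Properties as List
import Data.List.Membership.DecPropositional as DecMembership
open import Data.List.Relation.Unary.All as All using (All; []; _∷_)
import Data.List.Relation.Unary.All.Properties as All
open import Data.List.Relation.Unary.Any using (here; there)
open import Data.Product using (Σ; ∃; _×_; _,_; proj₁; proj₂; uncurry)
open import Data.Product.Function.NonDependent.Propositional using (_×-↔_)
open import Data.Sum using (_⊎_; inj₁; inj₂; [_,_]′) renaming (swap to ⊎-swap)
open import Data.Sum.Function.Propositional using (_⊎-↔_)
open import Data.Vec using (Vec; []; _∷_; lookup; tabulate; map; uncons; _++_; splitAt)
open import Data.Vec.Properties
  using (≡-dec; map-++; ∷-injectiveˡ; ∷-injectiveʳ; ++-injective; ++-injectiveˡ;
         lookup∘tabulate; tabulate∘lookup; tabulate-∘; tabulate-cong)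
open import Data.Vec.Relation.Unary.Any.Properties using (tabulate⁻)
open import Data.Vec.Relation.Unary.Unique.Propositional.Properties using (tabulate⁺)
open import Level using (0ℓ)
open import Function using (id; _∘_; Injective; _⤖_; _↔_; Inverse; mk↔ₛ′; mk⇔)
open import Function.Properties.Inverse using (↔-refl; ↔-sym; ↔-trans; ↔⇒↣)
open import Relation.Binary.PropositionalEquality
  using (_≡_; _≢_; refl; sym; trans; cong; cong₂; subst; module ≡-Reasoning)
open import Relation.Nullary using (¬_; Dec; does; yes; no; contradiction)
open import Relation.Nullary.Decidable
  using (_×-dec_; _⊎-dec_; ¬?; via-injection; decidable-stable; map′; dec-true; dec-false)
open import Relation.Unary using (Pred; Decidable)

-- Conditionals, enumeration of vectors, and comparison of prefixes.

if-true : ∀ {A : Set} {P : Set} (P? : Dec P) {x y : A} → P →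
          (if does P? then x else y) ≡ x
if-true P? p rewrite dec-true P? p = refl

if-false : ∀ {A : Set} {P : Set} (P? : Dec P) {x y : A} → ¬ P →
           (if does P? then x else y) ≡ y
if-false P? ¬p rewrite dec-false P? ¬p = refl

Vec↔Fin : ∀ {n} k → Vec (Fin n) k ↔ Fin (n ^ k)
Vec↔Fin zero    = mk↔ₛ′ (λ _ → zero) (λ _ → []) (λ { zero → refl }) (λ { [] → refl })
Vec↔Fin (suc k) = ↔-trans
  (mk↔ₛ′ uncons (uncurry _∷_) (λ _ → refl) (λ { (_ ∷ _) → refl }))
  (↔-trans (↔-refl ×-↔ Vec↔Fin k) (↔-sym *↔×))

agree : ∀ {n k} → Vec (Fin n) k → Vec (Fin n) k → Fin (suc k) → Bool
agree xs       ys       zero    = true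
agree (x ∷ xs) (y ∷ ys) (suc j) = does (x ≟ y) ∧ agree xs ys j

-- The recursion of `agree` peels off the first coordinate, whereas a chain of conjunctions appends
-- one test at the end; associativity of `_∧_` reconciles the two.
agree-suc : ∀ {n k} (xs ys : Vec (Fin n) k) j →
            agree xs ys (suc j) ≡ agree xs ys (inject₁ j) ∧ does (lookup xs j ≟ lookup ys j)
agree-suc (x ∷ xs) (y ∷ ys) zero    = ∧-identityʳ _
agree-suc (x ∷ xs) (y ∷ ys) (suc j) =
  trans (cong (does (x ≟ y) ∧_) (agree-suc xs ys j)) (sym (∧-assoc (does (x ≟ y)) _ _))

agree-refl : ∀ {n k} (xs : Vec (Fin n) k) j → agree xs xs j ≡ true
agree-refl xs       zero    = refl
agree-refl (x ∷ xs) (suc j) rewrite dec-true (x ≟ x) refl = agree-refl xs j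

agree⇒≡ : ∀ {n k} (xs ys : Vec (Fin n) k) → agree xs ys (fromℕ k) ≡ true → xs ≡ ys
agree⇒≡ []       []       _ = refl
agree⇒≡ (x ∷ xs) (y ∷ ys) p with x ≟ y
... | yes x≡y = cong₂ _∷_ x≡y (agree⇒≡ xs ys p)
agree⇒≡ (x ∷ xs) (y ∷ ys) () | no _

-- At most two of the colors 0, 1, 2 are excluded, so one of these three always remains.
fresh : ∀ {n} (a b : Fin (3 + n)) → ∃ λ c → c ≢ a × c ≢ b
fresh 0F            0F            = 1F , (λ ()) , (λ ())
fresh 0F            1F            = 2F , (λ ()) , (λ ())
fresh 0F            (suc (suc _)) = 1F , (λ ()) , (λ ())
fresh 1F            0F            = 2F , (λ ()) , (λ ())
fresh 1F            1F            = 0F , (λ ()) , (λ ())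
fresh 1F            (suc (suc _)) = 0F , (λ ()) , (λ ())
fresh (suc (suc _)) 0F            = 1F , (λ ()) , (λ ())
fresh (suc (suc _)) 1F            = 0F , (λ ()) , (λ ())
fresh (suc (suc _)) (suc (suc _)) = 0F , (λ ()) , (λ ())

-- Graphs given by neighbour lists on an enumerated type.

module FromNeighbours {V : Set} {N : ℕ} (V↔Fin : V ↔ Fin N)
                      (nbrs : V → List V) (irrefl : ∀ v → v ∉ nbrs v) where

  enc : V → Fin N
  enc = Inverse.to V↔Fin

  dec : Fin N → V
  dec = Inverse.from V↔Fin

  enc-dec : ∀ i → enc (dec i) ≡ i
  enc-dec = Inverse.strictlyInverseˡ V↔Fin

  dec-enc : ∀ v → dec (enc v) ≡ v
  dec-enc = Inverse.strictlyInverseʳ V↔Fin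

  enc-injective : Injective _≡_ _≡_ enc
  enc-injective p = trans (sym (dec-enc _)) (trans (cong dec p) (dec-enc _))

  -- Symmetrizing allows each edge to be listed at one end only, so that a coloring need only be
  -- checked along listed edges.
  Adjacent : V → V → Set
  Adjacent u v = v ∈ nbrs u ⊎ u ∈ nbrs v

  open DecMembership (via-injection (↔⇒↣ V↔Fin) _≟_) using (_∈?_)

  graph : Graph
  graph = record
    { order    = N
    ; _~_      = λ i j → Adjacent (dec i) (dec j)
    ; _~?_     = λ i j → (dec j ∈? nbrs (dec i)) ⊎-dec (dec i ∈? nbrs (dec j))
    ; ~-sym    = ⊎-swap
    ; ~-irrefl = λ { refl → [ irrefl _ , irrefl _ ]′ }
    }

  open Graph graph using (IsColoring)

  IsProper : ∀ {n} → (V → Fin n) → Set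
  IsProper σ = ∀ u v → v ∈ nbrs u → σ u ≢ σ v

  IsColoring⇒IsProper : ∀ {n} {σ : Fin N → Fin n} → IsColoring n σ → IsProper (σ ∘ enc)
  IsColoring⇒IsProper σ-col u v v∈ =
    σ-col {enc u} {enc v} (inj₁ (subst (_∈ nbrs (dec (enc u))) (sym (dec-enc v))
                                     (subst (λ w → v ∈ nbrs w) (sym (dec-enc u)) v∈)))

  IsProper⇒IsColoring : ∀ {n} {σ : V → Fin n} → IsProper σ → IsColoring n (σ ∘ dec)
  IsProper⇒IsColoring σ-prop (inj₁ v∈) = σ-prop _ _ v∈
  IsProper⇒IsColoring σ-prop (inj₂ u∈) = σ-prop _ _ u∈ ∘ sym

-- The graph whose terminals admit exactly the rows satisfying `R`.

module Recognizer (n′ N : ℕ) (R : Pred (Vec (Fin (3 + n′)) N) 0ℓ) (R? : Decidable R) where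

  C : Set
  C = Fin (3 + n′)

  Row : Set
  Row = Vec C N

  Test : Set
  Test = Fin N × C × C

  -- The vertex prefix r j has color 1 or 0 according to whether xs and r agree in
  -- their first j coordinates.
  data V : Set where
    ref     : C → V
    term    : Fin N → V
    decoder : Fin 3 → Test → C → V
    prefix  : Row → Fin (suc N) → V
    gate    : Row → Fin N → V
    check   : Row → V

  -- In the test (t , e , f), one decoder tells whether the t-th color is e, but only in
  -- a pair of colors containing e.  With a color c ∉ {e , f}, three successive
  -- decoders answer (yes , no) in the colors (c , e), then (f , c), then (2 , f).
  base : Fin 3 → Test → C
  base 0F (t , e , f) = proj₁ (fresh e f)
  base 1F (t , e , f) = f
  base 2F _           = 2F

  source : Fin 3 → Test → V
  source 0F (t , _)         = term t
  source 1F k@(t , e , f)   = decoder 0F k e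
  source 2F k               = decoder 1F k (base 0F k)

  tester : C → Row → Fin N → V
  tester f r j = decoder 2F (j , lookup r j , f) f

  -- The chain for `r` ends in color 1 on full agreement and in 0 otherwise. Color 2 on its
  -- neighbour `check r` therefore permits everything, while color 1 rules out exactly the terminal
  -- row `r`.
  verdict : Row → C
  verdict r = if does (R? r) then 2F else 1F

  palette : V → List C
  palette (ref i)            = i ∷ []
  palette (term _)           = allFin _
  palette (decoder ℓ k a)    = base ℓ k ∷ a ∷ []
  palette (prefix _ 0F)      = 1F ∷ []
  palette (prefix _ (suc _)) = 0F ∷ 1F ∷ []
  palette (gate _ _)         = 0F ∷ 1F ∷ 2F ∷ []
  palette (check r)          = verdict r ∷ []

  other? : ∀ a c → Decidable (λ (b : C) → b ≢ a × b ≢ c)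
  other? a c b = ¬? (b ≟ a) ×-dec ¬? (b ≟ c)

  -- A decoder of index `a` other than the base chooses between `a` and the base. Joining these
  -- decoders to the source and to one another lets only the index that equals the source's color
  -- take the base.
  clique : Fin 3 → Test → C → List V
  clique ℓ k a = List.map (decoder ℓ k) (filter (other? a (base ℓ k)) (allFin _))

  wires : V → List V
  wires (ref _)            = []
  wires (term _)           = []
  wires (decoder ℓ k a)    = if does (a ≟ base ℓ k) then [] else source ℓ k ∷ clique ℓ k a
  wires (prefix _ 0F)      = []
  -- If test `j` succeeds, both testers show 2, so the gate shows the negation of the previous bit
  -- and this vertex negates it back. If it fails, the testers show 0 and 1, so the gate shows 2 and
  -- tester 1 leaves only 0 here.
  wires (prefix r (suc j)) = gate r j ∷ tester 1F r j ∷ []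
  wires (gate r j)         = prefix r (inject₁ j) ∷ tester 0F r j ∷ tester 1F r j ∷ []
  wires (check r)          = prefix r (fromℕ N) ∷ []

  open DecMembership (_≟_ {3 + n′}) using (_∈?_; _∉?_)

  -- A palette is imposed by edges to the references of all colors outside it. Since `ref i` has
  -- palette `i ∷ []`, this also makes the references pairwise adjacent.
  forbidden : V → List C
  forbidden v = filter (_∉? palette v) (allFin _)

  nbrs : V → List V
  nbrs v = List.map ref (forbidden v) List.++ wires v

  -- With c = base ℓ k and x the color of source ℓ k, the color of decoder ℓ k a.
  override : C → C → C → C
  override c a x = if does (x ≟ a) then c else a

  override-hit : ∀ c a → override c a a ≡ c
  override-hit c a = if-true (a ≟ a) refl

  override-miss : ∀ c {a x} → x ≢ a → override c a x ≡ a
  override-miss c {a} {x} = if-false (x ≟ a)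

  override-self : ∀ a x → override a a x ≡ a
  override-self a x with x ≟ a
  ... | yes _ = refl
  ... | no _  = refl

  override-source : ∀ {c a} → a ≢ c → ∀ x → override c a x ≢ x
  override-source {c} {a} a≢c x eq with x ≟ a
  ... | yes x≡a = a≢c (sym (trans eq x≡a))
  ... | no x≢a  = x≢a (sym eq)

  -- The color `x` equals at most one of the two distinct indices, so at most one of them is
  -- replaced by `c`, and `c` is neither index.
  override-clique : ∀ {c a b} → a ≢ c → b ≢ a × b ≢ c → ∀ x → override c a x ≢ override c b x
  override-clique {c} {a} {b} a≢c (b≢a , b≢c) x eq with x ≟ a | x ≟ b
  ... | yes x≡a | yes x≡b = b≢a (trans (sym x≡b) x≡a)
  ... | yes _   | no _    = b≢c (sym eq)
  ... | no _    | yes _   = a≢c eq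
  ... | no _    | no _    = b≢a (sym eq)

  -- Truth tables of the conjunction gate.

  bit : Bool → C
  bit b = if b then 1F else 0F

  test : C → Bool → C
  test f b = if b then 2F else f

  -- The color that remains in {0 , 1 , 2} beside bit P, test 0 Q and test 1 Q.
  gate-value : Bool → Bool → C
  gate-value true  true  = 0F
  gate-value false true  = 1F
  gate-value _     false = 2F

  gate-value≢bit : ∀ P Q → gate-value P Q ≢ bit P
  gate-value≢bit true  true  ()
  gate-value≢bit true  false ()
  gate-value≢bit false true  ()
  gate-value≢bit false false ()

  gate-value≢test0 : ∀ P Q → gate-value P Q ≢ test 0F Q
  gate-value≢test0 true  true  ()
  gate-value≢test0 true  false ()
  gate-value≢test0 false true  ()
  gate-value≢test0 false false ()

  gate-value≢test1 : ∀ P Q → gate-value P Q ≢ test 1F Q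
  gate-value≢test1 true  true  ()
  gate-value≢test1 true  false ()
  gate-value≢test1 false true  ()
  gate-value≢test1 false false ()

  bit∧≢gate-value : ∀ P Q → bit (P ∧ Q) ≢ gate-value P Q
  bit∧≢gate-value true  true  ()
  bit∧≢gate-value true  false ()
  bit∧≢gate-value false true  ()
  bit∧≢gate-value false false ()

  bit∧≢test : ∀ P Q → bit (P ∧ Q) ≢ test 1F Q
  bit∧≢test true  true  ()
  bit∧≢test true  false ()
  bit∧≢test false true  ()
  bit∧≢test false false ()

  gate-value-unique : ∀ P Q {y} → y ∈ 0F ∷ 1F ∷ 2F ∷ [] →
                      y ≢ bit P → y ≢ test 0F Q → y ≢ test 1F Q → y ≡ gate-value P Q
  gate-value-unique true  true  (here p)                 _ _ _ = p
  gate-value-unique true  true  (there (here p))         a _ _ = ⊥-elim (a p)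
  gate-value-unique true  true  (there (there (here p))) _ b _ = ⊥-elim (b p)
  gate-value-unique false true  (here p)                 a _ _ = ⊥-elim (a p)
  gate-value-unique false true  (there (here p))         _ _ _ = p
  gate-value-unique false true  (there (there (here p))) _ b _ = ⊥-elim (b p)
  gate-value-unique _     false (here p)                 _ b _ = ⊥-elim (b p)
  gate-value-unique _     false (there (here p))         _ _ c = ⊥-elim (c p)
  gate-value-unique true  false (there (there (here p))) _ _ _ = p
  gate-value-unique false false (there (there (here p))) _ _ _ = p

  bit∧-unique : ∀ P Q {u} → u ∈ 0F ∷ 1F ∷ [] →
                u ≢ gate-value P Q → u ≢ test 1F Q → u ≡ bit (P ∧ Q)
  bit∧-unique true  true  (here p)         a _ = ⊥-elim (a p)
  bit∧-unique true  true  (there (here p)) _ _ = p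
  bit∧-unique false true  (here p)         _ _ = p
  bit∧-unique false true  (there (here p)) a _ = ⊥-elim (a p)
  bit∧-unique true  false (here p)         _ _ = p
  bit∧-unique false false (here p)         _ _ = p
  bit∧-unique true  false (there (here p)) _ b = ⊥-elim (b p)
  bit∧-unique false false (there (here p)) _ b = ⊥-elim (b p)

  -- The coloring determined by the colors of the terminals.

  module Value (xs : Row) where

    -- The color that stage `ℓ` receives from its source. Listing it by stages spares `value` a
    -- recursion through `source`, which would not be structural.
    signal : Fin 3 → Test → C
    signal 0F (t , _)       = lookup xs t
    signal 1F k@(_ , e , _) = override (base 0F k) e (signal 0F k)
    signal 2F k@(_ , e , _) = override (base 1F k) (base 0F k)
      (override (base 0F k) e (signal 0F k))

    matches : Row → Fin N → Bool
    matches r j = does (lookup xs j ≟ lookup r j)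

    value : V → C
    value (ref i)         = i
    value (term t)        = lookup xs t
    value (decoder ℓ k a) = override (base ℓ k) a (signal ℓ k)
    value (prefix r j)    = bit (agree xs r j)
    value (gate r j)      = gate-value (agree xs r (inject₁ j)) (matches r j)
    value (check r)       = verdict r

    value-source : ∀ ℓ k → value (source ℓ k) ≡ signal ℓ k
    value-source 0F _ = refl
    value-source 1F _ = refl
    value-source 2F _ = refl

    -- On a match the overrides fire in all three stages. On a mismatch the first stage yields `e`;
    -- then `c ≢ e` makes the second yield `c`, and `c ≢ f` makes the third yield `f`.
    value-tester : ∀ {f} → f ≢ 2F → ∀ r j → value (tester f r j) ≡ test f (matches r j)
    value-tester {f} f≢2 r j with fresh (lookup r j) f | lookup xs j ≟ lookup r j
    ... | c , c≢e , c≢f | yes _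
      rewrite override-hit f c | override-hit 2F f = refl
    ... | c , c≢e , c≢f | no _
      rewrite override-miss f (c≢e ∘ sym) = override-miss 2F c≢f

    value-prefix : ∀ r j → value (prefix r (suc j)) ≡ bit (agree xs r (inject₁ j) ∧ matches r j)
    value-prefix r j = cong bit (agree-suc xs r j)

    value∈palette : ∀ v → value v ∈ palette v
    value∈palette (ref i)  = here refl
    value∈palette (term t) = ∈-allFin _
    value∈palette (decoder ℓ k a) with signal ℓ k ≟ a
    ... | yes _ = here refl
    ... | no _  = there (here refl)
    value∈palette (prefix r 0F) = here refl
    value∈palette (prefix r (suc j)) with agree xs r (suc j)
    ... | true  = there (here refl)
    ... | false = here refl
    value∈palette (gate r j) with agree xs r (inject₁ j) | matches r j
    ... | true  | true  = here refl
    ... | false | true  = there (here refl)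
    ... | true  | false = there (there (here refl))
    ... | false | false = there (there (here refl))
    value∈palette (check r) = here refl

    module _ (R-xs : R xs) where

      value-wires : ∀ v → All (λ w → value v ≢ value w) (wires v)
      value-wires (ref _)  = []
      value-wires (term _) = []
      value-wires (decoder ℓ k a) with a ≟ base ℓ k
      ... | yes _  = []
      ... | no a≢c =
        subst (λ x → value (decoder ℓ k a) ≢ x) (sym (value-source ℓ k))
              (override-source a≢c (signal ℓ k))
        ∷ All.map⁺ (All.map (λ b≢ → override-clique a≢c b≢ (signal ℓ k))
                            (All.all-filter (other? a (base ℓ k)) (allFin _)))
      value-wires (prefix _ 0F) = []
      value-wires (prefix r (suc j)) =
        (λ p → bit∧≢gate-value P Q (trans (sym (value-prefix r j)) p))
        ∷ (λ p → bit∧≢test P Q (trans (sym (value-prefix r j))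
                                       (trans p (value-tester {1F} (λ ()) r j))))
        ∷ []
        where P = agree xs r (inject₁ j) ; Q = matches r j
      value-wires (gate r j) =
        gate-value≢bit P Q
        ∷ (λ p → gate-value≢test0 P Q (trans p (value-tester {0F} (λ ()) r j)))
        ∷ (λ p → gate-value≢test1 P Q (trans p (value-tester {1F} (λ ()) r j)))
        ∷ []
        where P = agree xs r (inject₁ j) ; Q = matches r j
      value-wires (check r) = verdict≢bit ∷ []
        where
        verdict≢bit : verdict r ≢ bit (agree xs r (fromℕ N))
        verdict≢bit with R? r | agree xs r (fromℕ N) in eq
        ... | yes _  | true  = λ ()
        ... | yes _  | false = λ ()
        -- The only possible conflict: full agreement would identify the rejected `r` with `xs`,
        -- which satisfies `R`.
        ... | no ¬Rr | true  = ⊥-elim (¬Rr (subst R (agree⇒≡ xs r eq) R-xs))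
        ... | no _   | false = λ ()

      value-proper : ∀ u v → v ∈ nbrs u → value u ≢ value v
      value-proper u _ = All.lookup (All.++⁺
        (All.map⁺ (All.map (λ c∉ u≡c → c∉ (subst (_∈ palette u) u≡c (value∈palette u)))
                           (All.all-filter (_∉? palette u) (allFin _))))
        (value-wires u))

  refs-adjacent : ∀ {i j} → i ≢ j → ref j ∈ nbrs (ref i)
  refs-adjacent {i} {j} i≢j = ∈-++⁺ˡ (∈-map⁺ ref (∈-filter⁺ (_∉? palette (ref i)) (∈-allFin j)
    λ { (here j≡i) → i≢j (sym j≡i) }))

  open Value public

  -- Every proper coloring normalized on the references is a `value` coloring.

  module Forced (σ : V → C) (σ-proper : ∀ u v → v ∈ nbrs u → σ u ≢ σ v)
                (σ-ref : ∀ i → σ (ref i) ≡ i) where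

    xs : Row
    xs = tabulate (σ ∘ term)

    -- Otherwise `v` would be adjacent to the reference of its own color.
    σ∈palette : ∀ v → σ v ∈ palette v
    σ∈palette v = decidable-stable (σ v ∈? palette v) λ σv∉ →
      (σ-proper v (ref (σ v)) (∈-++⁺ˡ (∈-map⁺ ref (∈-filter⁺ (_∉? palette v) (∈-allFin (σ v)) σv∉)))
                (sym (σ-ref (σ v))))

    σ-wire : ∀ {v w} → w ∈ wires v → σ v ≢ σ w
    σ-wire {v} {w} w∈ = σ-proper v w (∈-++⁺ʳ (List.map ref (forbidden v)) w∈)

    module _ (ℓ : Fin 3) (k : Test) where

      private
        c = base ℓ k

      σ-source : ∀ {a} → a ≢ c → σ (decoder ℓ k a) ≢ σ (source ℓ k)
      σ-source {a} a≢c = σ-wire {decoder ℓ k a}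
        (subst (source ℓ k ∈_) (sym (if-false (a ≟ c) a≢c)) (here refl))

      σ-clique : ∀ {a b} → a ≢ c → b ≢ a → b ≢ c → σ (decoder ℓ k a) ≢ σ (decoder ℓ k b)
      σ-clique {a} {b} a≢c b≢a b≢c = σ-wire {decoder ℓ k a}
        (subst (decoder ℓ k b ∈_) (sym (if-false (a ≟ c) a≢c))
          (there (∈-map⁺ (decoder ℓ k) (∈-filter⁺ (other? a c) (∈-allFin b) (b≢a , b≢c)))))

      -- If the source has color s ∉ {a , c}, then decoder s cannot have color s,
      -- so it has color c and takes c away from decoder a.
      σ-decoder : ∀ a → σ (decoder ℓ k a) ≡ override c a (σ (source ℓ k))
      σ-decoder a with a ≟ c | σ∈palette (decoder ℓ k a)
      ... | yes refl | here p         = trans p (sym (override-self a (σ (source ℓ k))))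
      ... | yes refl | there (here p) = trans p (sym (override-self a (σ (source ℓ k))))
      ... | no a≢c   | σa∈ with σ (source ℓ k) ≟ a
      σ-decoder a | no a≢c | here p         | yes _   = p
      σ-decoder a | no a≢c | there (here p) | yes s≡a = ⊥-elim (σ-source a≢c (trans p (sym s≡a)))
      σ-decoder a | no a≢c | there (here p) | no _    = p
      σ-decoder a | no a≢c | here p         | no s≢a
        with σ (source ℓ k) ≟ c | σ∈palette (decoder ℓ k (σ (source ℓ k)))
      ... | yes s≡c | _              = ⊥-elim (σ-source a≢c (trans p (sym s≡c)))
      ... | no s≢c  | here q         = ⊥-elim
        (σ-clique {a} {σ (source ℓ k)} a≢c s≢a s≢c (trans p (sym q)))
      ... | no s≢c  | there (here q) = ⊥-elim (σ-source {σ (source ℓ k)} s≢c q)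

    signal-forced : ∀ ℓ k → σ (source ℓ k) ≡ signal xs ℓ k
    signal-forced 0F (t , _)       = sym (lookup∘tabulate (σ ∘ term) t)
    signal-forced 1F k@(_ , e , _) = trans (σ-decoder 0F k e)
      (cong (override (base 0F k) e) (signal-forced 0F k))
    signal-forced 2F k@(_ , e , _) = trans (σ-decoder 1F k (base 0F k))
      (cong (override (base 1F k) (base 0F k)) (trans (σ-decoder 0F k e)
        (cong (override (base 0F k) e) (signal-forced 0F k))))

    decoder-forced : ∀ ℓ k a → σ (decoder ℓ k a) ≡ value xs (decoder ℓ k a)
    decoder-forced ℓ k a =
      trans (σ-decoder ℓ k a) (cong (override (base ℓ k) a) (signal-forced ℓ k))

    tester-forced : ∀ {f} → f ≢ 2F → ∀ r j → σ (tester f r j) ≡ test f (matches xs r j)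
    tester-forced f≢2 r j = trans (decoder-forced 2F _ _) (value-tester xs f≢2 r j)

    module _ (r : Row) where

      gate-forced : ∀ j → σ (prefix r (inject₁ j)) ≡ value xs (prefix r (inject₁ j)) →
                    σ (gate r j) ≡ value xs (gate r j)
      gate-forced j prefix≡ = gate-value-unique _ _ (σ∈palette (gate r j))
        (λ p → σ-wire {gate r j} (here refl) (trans p (sym prefix≡)))
        (λ p → σ-wire {gate r j} (there (here refl))
                 (trans p (sym (tester-forced {0F} (λ ()) r j))))
        (λ p → σ-wire {gate r j} (there (there (here refl)))
                 (trans p (sym (tester-forced {1F} (λ ()) r j))))

      -- Induction along the chain: a prefix forces the next gate, and the gate together with tester
      -- 1 forces the next prefix. It starts from the empty prefix, whose palette is the single
      -- color 1.
      prefix-forced : ∀ j → σ (prefix r j) ≡ value xs (prefix r j)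
      prefix-forced = <-weakInduction (λ j → σ (prefix r j) ≡ value xs (prefix r j)) first next
        where
        first : σ (prefix r 0F) ≡ value xs (prefix r 0F)
        first with here p ← σ∈palette (prefix r 0F) = p

        next : ∀ j → σ (prefix r (inject₁ j)) ≡ value xs (prefix r (inject₁ j)) →
               σ (prefix r (suc j)) ≡ value xs (prefix r (suc j))
        next j ih = trans
          (bit∧-unique (agree xs r (inject₁ j)) (matches xs r j) (σ∈palette (prefix r (suc j)))
            (λ p → σ-wire {prefix r (suc j)} (here refl) (trans p (sym (gate-forced j ih))))
            (λ p → σ-wire {prefix r (suc j)} (there (here refl))
                     (trans p (sym (tester-forced {1F} (λ ()) r j)))))
          (sym (value-prefix xs r j))

    forced : ∀ v → σ v ≡ value xs v
    forced (ref i)         = σ-ref i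
    forced (term t)        = sym (lookup∘tabulate (σ ∘ term) t)
    forced (decoder ℓ k a) = decoder-forced ℓ k a
    forced (prefix r j)    = prefix-forced r j
    forced (gate r j)      = gate-forced r j (prefix-forced r (inject₁ j))
    forced (check r) with here p ← σ∈palette (check r) = p

    -- The chain for `xs` itself ends in color 1, since `xs` agrees with itself. If `R xs` failed,
    -- the adjacent `check xs` would have color 1 as well.
    R-xs : R xs
    R-xs = decidable-stable (R? xs) λ ¬p → σ-wire {check xs} (here refl) (begin
      σ (check xs)                    ≡⟨ forced (check xs) ⟩
      verdict xs                      ≡⟨ if-false (R? xs) ¬p ⟩
      1F                              ≡⟨ cong bit (agree-refl xs (fromℕ N)) ⟨
      bit (agree xs xs (fromℕ N))     ≡⟨ prefix-forced xs (fromℕ N) ⟨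
      σ (prefix xs (fromℕ N))         ∎)
      where open ≡-Reasoning

  -- Enumeration of the vertices.

  order : ℕ
  -- One summand per constructor of `V`, in order; the decoders count three stages, `N * (n * n)`
  -- tests and `n` indices.
  order = n + (N + (3 * (N * (n * n) * n) + (n ^ N * suc N + (n ^ N * N + n ^ N))))
    where n = 3 + n′

  V↔Fin : V ↔ Fin order
  V↔Fin = ↔-trans sum (↔-sym
    (↔-trans +↔⊎ (↔-refl ⊎-↔
    (↔-trans +↔⊎ (↔-refl ⊎-↔
    (↔-trans +↔⊎ (decoders ⊎-↔
    (↔-trans +↔⊎ (↔-trans *↔× (row ×-↔ ↔-refl) ⊎-↔
    (↔-trans +↔⊎ (↔-trans *↔× (row ×-↔ ↔-refl) ⊎-↔ row)))))))))))
    where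
    decoders : Fin (3 * (N * ((3 + n′) * (3 + n′)) * (3 + n′))) ↔ (Fin 3 × Test × C)
    decoders = ↔-trans *↔× (↔-refl ×-↔ ↔-trans *↔× (↔-trans *↔× (↔-refl ×-↔ *↔×) ×-↔ ↔-refl))

    row : Fin ((3 + n′) ^ N) ↔ Row
    row = ↔-sym (Vec↔Fin N)

    Sum : Set
    Sum = C ⊎ Fin N ⊎ (Fin 3 × Test × C) ⊎ (Row × Fin (suc N)) ⊎ (Row × Fin N) ⊎ Row

    to : V → Sum
    to (ref i)         = inj₁ i
    to (term t)        = inj₂ (inj₁ t)
    to (decoder ℓ k a) = inj₂ (inj₂ (inj₁ (ℓ , k , a)))
    to (prefix r j)    = inj₂ (inj₂ (inj₂ (inj₁ (r , j))))
    to (gate r j)      = inj₂ (inj₂ (inj₂ (inj₂ (inj₁ (r , j)))))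
    to (check r)       = inj₂ (inj₂ (inj₂ (inj₂ (inj₂ r))))

    from : Sum → V
    from (inj₁ i)                                    = ref i
    from (inj₂ (inj₁ t))                             = term t
    from (inj₂ (inj₂ (inj₁ (ℓ , k , a))))            = decoder ℓ k a
    from (inj₂ (inj₂ (inj₂ (inj₁ (r , j)))))         = prefix r j
    from (inj₂ (inj₂ (inj₂ (inj₂ (inj₁ (r , j))))))  = gate r j
    from (inj₂ (inj₂ (inj₂ (inj₂ (inj₂ r)))))        = check r

    to-from : ∀ s → to (from s) ≡ s
    to-from (inj₁ _)                             = refl
    to-from (inj₂ (inj₁ _))                      = refl
    to-from (inj₂ (inj₂ (inj₁ _)))               = refl
    to-from (inj₂ (inj₂ (inj₂ (inj₁ _))))        = refl
    to-from (inj₂ (inj₂ (inj₂ (inj₂ (inj₁ _))))) = refl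
    to-from (inj₂ (inj₂ (inj₂ (inj₂ (inj₂ _))))) = refl

    from-to : ∀ v → from (to v) ≡ v
    from-to (ref _)         = refl
    from-to (term _)        = refl
    from-to (decoder _ _ _) = refl
    from-to (prefix _ _)    = refl
    from-to (gate _ _)      = refl
    from-to (check _)       = refl

    sum : V ↔ Sum
    sum = mk↔ₛ′ to from to-from from-to

-- Concatenated tabulations, and vectors of symbols as vectors of colors.

tabulate-++ : ∀ {A : Set} p {q} (f : Fin (p + q) → A) →
              tabulate (f ∘ (_↑ˡ q)) ++ tabulate (f ∘ (p ↑ʳ_)) ≡ tabulate f
tabulate-++ zero    f = refl
tabulate-++ (suc p) f = cong (f zero ∷_) (tabulate-++ p (f ∘ suc))

map-injective : ∀ {A B : Set} {f : A → B} → Injective _≡_ _≡_ f →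
                ∀ {k} → Injective _≡_ _≡_ (map {n = k} f)
map-injective f-inj {x = []}     {[]}     _ = refl
map-injective f-inj {x = _ ∷ _} {_ ∷ _} p =
  cong₂ _∷_ (f-inj (∷-injectiveˡ p)) (map-injective f-inj (∷-injectiveʳ p))

module _ {m n} (m≤n : m ≤ n) where

  toColors-injective : ∀ {k} → Injective _≡_ _≡_ (toColors {k = k} m≤n)
  toColors-injective = map-injective (inject≤-injective m≤n m≤n _ _)

  toSymbol? : ∀ c → Dec (∃ λ s → inject≤ s m≤n ≡ c)
  toSymbol? c with toℕ c <? m
  ... | yes c<m = yes (fromℕ< c<m , toℕ-injective
                        (trans (toℕ-inject≤ (fromℕ< c<m) m≤n) (toℕ-fromℕ< c<m)))
  ... | no c≮m  = no λ { (s , refl) → c≮m (subst (_< m) (sym (toℕ-inject≤ s m≤n)) (toℕ<n s)) }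

  toSymbols? : ∀ {k} (cs : Vec (Fin n) k) → Dec (∃ λ s → toColors m≤n s ≡ cs)
  toSymbols? []       = yes ([] , refl)
  toSymbols? (c ∷ cs) = map′
    (λ ((s , p) , (ss , ps)) → s ∷ ss , cong₂ _∷_ p ps)
    (λ { (s ∷ ss , p) → (s , ∷-injectiveˡ p) , (ss , ∷-injectiveʳ p) })
    (toSymbol? c ×-dec toSymbols? cs)

-- The recognizer of the graph of `φ` simulates `φ`.

module Simulator (p q m n′ : ℕ) (m≤n : m ≤ 3 + n′)
                 (φ : PartialFunction m p q) (dom : ∃ (_∈Dom φ)) where

  row : Vec (Fin m) p → Vec (Fin m) q → Vec (Fin (3 + n′)) (p + q)
  row s t = toColors m≤n (s ++ t)

  row-injective : ∀ {s s′ t t′} → row s t ≡ row s′ t′ → s ≡ s′ × t ≡ t′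
  row-injective = ++-injective _ _ ∘ toColors-injective m≤n

  IsGraphPoint : Pred (Vec (Fin (3 + n′)) (p + q)) 0ℓ
  IsGraphPoint r = ∃ λ s → ∃ λ t → φ s ≡ just t × row s t ≡ r

  -- A row of colors decodes into symbols in at most one way, and splitting at `p` then leaves a
  -- single candidate pair, so the existential reduces to testing `φ s ≡ just t`.
  isGraphPoint? : Decidable IsGraphPoint
  isGraphPoint? r with toSymbols? m≤n r
  ... | no ¬symbols = no λ (s , t , _ , eq) → ¬symbols (s ++ t , eq)
  ... | yes (st , refl) with splitAt p st
  ...   | s , t , refl = map′
    (λ φs≡t → s , t , φs≡t , refl)
    (λ (s′ , t′ , φs′≡t′ , eq) → let s′≡s , t′≡t = row-injective eq in
      subst (λ x → φ x ≡ just t) s′≡s (trans φs′≡t′ (cong just t′≡t)))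
    (Maybe.≡-dec (≡-dec _≟_) (φ s) (just t))

  open Recognizer n′ (p + q) IsGraphPoint isGraphPoint?

  isGraphPoint-row : ∀ {s t} → φ s ≡ just t → IsGraphPoint (row s t)
  isGraphPoint-row φs≡t = _ , _ , φs≡t , refl

  open FromNeighbours V↔Fin nbrs
    -- No vertex is its own neighbour, because a loop would contradict the proper coloring attached
    -- to a point of the nonempty domain.
    (λ v v∈ → value-proper _ (isGraphPoint-row (proj₂ (proj₂ dom))) v v v∈ refl) public

  open Graph graph using (Vertex; IsColoring)

  inputs : Vec Vertex p
  inputs = tabulate (λ i → enc (term (i ↑ˡ q)))

  outputs : Vec Vertex q
  outputs = tabulate (λ j → enc (term (p ↑ʳ j)))

  term-injective : ∀ {i j} → enc (term i) ≡ enc (term j) → i ≡ j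
  term-injective eq with refl ← enc-injective {term _} {term _} eq = refl

  ref≢term : ∀ {i j} → enc (ref i) ≢ enc (term j)
  ref≢term eq with () ← enc-injective {ref _} {term _} eq

  terminals : Terminals graph p q (3 + n′)
  terminals = record
    { inputs         = inputs
    ; outputs        = outputs
    ; ref            = enc ∘ ref
    ; inputs-unique  = tabulate⁺ (↑ˡ-injective q _ _ ∘ term-injective)
    ; outputs-unique = tabulate⁺ (↑ʳ-injective p _ _ ∘ term-injective)
    ; ref∉inputs     = λ i → ref≢term ∘ proj₂ ∘ tabulate⁻
    }

  terminal-row : ∀ (σ : Vertex → C) → map σ inputs ++ map σ outputs ≡ tabulate (σ ∘ enc ∘ term)
  terminal-row σ = begin
    map σ inputs ++ map σ outputs
      ≡⟨ cong₂ _++_ (tabulate-∘ σ (λ i → enc (term (i ↑ˡ q))))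
                   (tabulate-∘ σ (λ j → enc (term (p ↑ʳ j)))) ⟨
    tabulate (λ i → σ (enc (term (i ↑ˡ q)))) ++ tabulate (λ j → σ (enc (term (p ↑ʳ j))))
      ≡⟨ tabulate-++ p (σ ∘ enc ∘ term) ⟩
    tabulate (σ ∘ enc ∘ term) ∎
    where open ≡-Reasoning

  coloring : Vec (Fin m) p → Vec (Fin m) q → Vertex → C
  coloring s t = value (row s t) ∘ dec

  coloring-isColoring : ∀ {s t} → φ s ≡ just t → IsColoring (3 + n′) (coloring s t)
  coloring-isColoring {s} {t} φs≡t {u} {v} = IsProper⇒IsColoring {σ = value (row s t)}
    (value-proper (row s t) (isGraphPoint-row φs≡t)) {u} {v}

  coloring-extends : ∀ {s t} → φ s ≡ just t →
                     IsExtension terminals (toColors m≤n s) (coloring s t)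
  coloring-extends {s} {t} φs≡t = record
    { isColoring = λ {u} {v} → coloring-isColoring φs≡t {u} {v}
    ; on-inputs  = ++-injectiveˡ _ _ (begin
        map σ inputs ++ map σ outputs      ≡⟨ terminal-row σ ⟩
        tabulate (σ ∘ enc ∘ term)
          ≡⟨ tabulate-cong (λ j → cong (value (row s t)) (dec-enc (term j))) ⟩
        tabulate (lookup (row s t))        ≡⟨ tabulate∘lookup (row s t) ⟩
        row s t                            ≡⟨ map-++ _ s t ⟩
        toColors m≤n s ++ toColors m≤n t   ∎)
    ; on-refs    = λ i → cong (value (row s t)) (dec-enc (ref i))
    }
    where
    open ≡-Reasoning
    σ = coloring s t

  -- The terminal colors of an extension form a row satisfying `IsGraphPoint`, and that row forces
  -- all other colors. One direction of `extendable`, the uniqueness and the output values all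
  -- follow from this.
  extension-forced : ∀ {a σ} → IsExtension terminals a σ →
    ∃ λ s → ∃ λ t → φ s ≡ just t × toColors m≤n s ≡ a × toColors m≤n t ≡ map σ outputs ×
                    (∀ v → σ v ≡ coloring s t v)
  extension-forced {a} {σ} ext =
    let s , t , φs≡t , row≡xs = R-xs
        s-inputs , t-outputs = ++-injective _ _ (begin
          toColors m≤n s ++ toColors m≤n t  ≡⟨ map-++ _ s t ⟨
          row s t                           ≡⟨ row≡xs ⟩
          tabulate (σ ∘ enc ∘ term)         ≡⟨ terminal-row σ ⟨
          map σ inputs ++ map σ outputs     ∎)
    in s , t , φs≡t , trans s-inputs on-inputs , t-outputs , λ v → begin
         σ v                                         ≡⟨ cong σ (enc-dec v) ⟨
         σ (enc (dec v))                             ≡⟨ forced (dec v) ⟩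
         value (tabulate (σ ∘ enc ∘ term)) (dec v)   ≡⟨ cong (λ xs → value xs (dec v)) row≡xs ⟨
         coloring s t v                              ∎
    where
    open ≡-Reasoning
    open IsExtension ext
    open Forced (σ ∘ enc) (IsColoring⇒IsProper {σ = σ} (λ {i} {j} → isColoring {i} {j})) on-refs
      using (R-xs; forced)

  simulates : Simulates terminals m≤n φ
  simulates = record
    { colorable     = let s , t , φs≡t = dom in
        coloring s t , λ {u} {v} → coloring-isColoring φs≡t {u} {v}
    ; refs-distinct = λ σ σ-col {i} {j} σi≡σj → decidable-stable (i ≟ j) λ i≢j →
        IsColoring⇒IsProper {σ = σ} (λ {u} {v} → σ-col {u} {v}) (ref i) (ref j)
          (refs-adjacent i≢j) σi≡σj
    ; extendable    = λ a → mk⇔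
        (λ (σ , ext) → let s , t , φs≡t , s≡a , _ = extension-forced ext in s , (t , φs≡t) , s≡a)
        (λ { (s , (t , φs≡t) , refl) → coloring s t , coloring-extends φs≡t })
    ; unique        = λ a σ τ ext ext′ v →
        let s  , t  , φs≡t   , s≡a  , _ , σ≡ = extension-forced ext
            s′ , t′ , φs′≡t′ , s′≡a , _ , τ≡ = extension-forced ext′
            s≡s′ = toColors-injective m≤n (trans s≡a (sym s′≡a))
            t≡t′ = functional φs≡t φs′≡t′ s≡s′
        in trans (σ≡ v) (trans (cong₂ (λ s t → coloring s t v) s≡s′ t≡t′) (sym (τ≡ v)))
    ; outputs-value = λ s t σ φs≡t ext →
        let s′ , t′ , φs′≡t′ , s′≡s , t′≡out , _ = extension-forced ext
        in trans (sym t′≡out) (cong (toColors m≤n)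
             (functional φs′≡t′ φs≡t (toColors-injective m≤n s′≡s)))
    }
    where
    functional : ∀ {s s′ t t′} → φ s ≡ just t → φ s′ ≡ just t′ → s ≡ s′ → t ≡ t′
    functional φs≡t φs′≡t′ refl = just-injective (trans (sym φs≡t) φs′≡t′)

-- Bounds on the order and the size.

length-cartesianProduct : ∀ {A B : Set} (xs : List A) (ys : List B) →
                          length (cartesianProduct xs ys) ≡ length xs * length ys
length-cartesianProduct []       ys = refl
length-cartesianProduct (x ∷ xs) ys = trans (List.length-++ (List.map (x ,_) ys))
  (cong₂ _+_ (List.length-map (x ,_) ys) (length-cartesianProduct xs ys))

size≤order² : ∀ G → Graph.size G ≤ Graph.order G * Graph.order G
size≤order² G = begin
  Graph.size G                                   ≤⟨ List.length-filter _ pairs ⟩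
  length pairs                                   ≡⟨ length-cartesianProduct (allFin N) (allFin N) ⟩
  length (allFin N) * length (allFin N)          ≡⟨ cong₂ _*_ length-allFin length-allFin ⟩
  N * N                                          ∎
  where
  open ≤-Reasoning
  N = Graph.order G
  pairs = cartesianProduct (allFin N) (allFin N)

  length-allFin : length (allFin N) ≡ N
  length-allFin = List.length-tabulate id

k≤n^k : ∀ n′ k → k ≤ (2 + n′) ^ k
k≤n^k n′ zero    = z≤n
k≤n^k n′ (suc k) = begin
  1 + k               ≤⟨ +-mono-≤ (m^n>0 n k) (k≤n^k n′ k) ⟩
  n ^ k + n ^ k       ≤⟨ +-monoʳ-≤ (n ^ k) (m≤m+n (n ^ k) (n′ * n ^ k)) ⟩
  n * n ^ k           ∎
  where
  open ≤-Reasoning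
  n = 2 + n′

module Bounds (n′ N : ℕ) (2≤N : 2 ≤ N) where

  private
    n K B : ℕ
    n = 3 + n′
    K = n ^ N
    -- This is `N * n ^ (1 + N)` by definition of the power, the form used in the final bounds.
    B = N * (n * K)

    instance
      N≢0 : NonZero N
      N≢0 = >-nonZero (≤-trans (s≤s z≤n) 2≤N)

      K≢0 : NonZero K
      K≢0 = m^n≢0 n N

  -- After `regroup`, the decoders contribute `3 * B` and each of the six other summands at most
  -- `B`. For the decoders, `2 ≤ N` gives `n * n ≤ n ^ N`.
  order-bound : n + (N + (3 * (N * (n * n) * n) + (K * suc N + (K * N + K)))) ≤ 9 * B
  order-bound = begin
    n + (N + (3 * (N * (n * n) * n) + (K * suc N + (K * N + K))))
      ≡⟨ regroup n N K ⟩
    n + (N + (3 * (N * (n * (n * n))) + (K + (K + (N * K + N * K)))))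
      ≤⟨ +-mono-≤ n≤B (+-mono-≤ (m≤m*n N (n * K)) (+-mono-≤ (*-monoʳ-≤ 3 n³≤B)
           (+-mono-≤ K≤B (+-mono-≤ K≤B (+-mono-≤ NK≤B NK≤B))))) ⟩
    B + (B + (3 * B + (B + (B + (B + B)))))
      ≡⟨ collect B ⟩
    9 * B ∎
    where
    open ≤-Reasoning
    instance
      nK≢0 : NonZero (n * K)
      nK≢0 = m*n≢0 n K

    regroup : ∀ n N K → n + (N + (3 * (N * (n * n) * n) + (K * suc N + (K * N + K)))) ≡
                        n + (N + (3 * (N * (n * (n * n))) + (K + (K + (N * K + N * K)))))
    regroup = solve-∀

    collect : ∀ B → B + (B + (3 * B + (B + (B + (B + B))))) ≡ 9 * B
    collect = solve-∀

    n≤B : n ≤ B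
    n≤B = ≤-trans (m≤m*n n K) (m≤n*m (n * K) N)

    K≤B : K ≤ B
    K≤B = ≤-trans (m≤n*m K n) (m≤n*m (n * K) N)

    NK≤B : N * K ≤ B
    NK≤B = *-monoʳ-≤ N (m≤n*m K n)

    n³≤B : N * (n * (n * n)) ≤ B
    n³≤B = *-monoʳ-≤ N (*-monoʳ-≤ n (subst (λ x → n * x ≤ K) (*-identityʳ n) (^-monoʳ-≤ n 2≤N)))

  module _ {Θ order : ℕ} (1≤Θ : 1 ≤ Θ) (order≤9B : order ≤ 9 * B) where

    private
      open ≤-Reasoning
      instance
        Θ≢0 : NonZero Θ
        Θ≢0 = >-nonZero 1≤Θ

    vertex-bound : order ≤ 9 * (Θ * N * n ^ (2 * N + 4))
    vertex-bound = begin
      order                          ≤⟨ order≤9B ⟩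
      9 * (N * n ^ (1 + N))          ≤⟨ *-monoʳ-≤ 9 (*-mono-≤ (m≤n*m N Θ) (^-monoʳ-≤ n exponent)) ⟩
      9 * (Θ * N * n ^ (2 * N + 4))  ∎
      where
      split : ∀ N → 2 * N + 4 ≡ (1 + N) + (N + 3)
      split = solve-∀

      exponent : 1 + N ≤ 2 * N + 4
      exponent = subst (1 + N ≤_) (sym (split N)) (m≤m+n (1 + N) (N + 3))

    -- Squaring `9 * B` gives 81 times `N` squared times a power of `n` with exponent `2 * N + 2`.
    -- One factor `N` is at most `n ^ N`, which raises the exponent to `3 * N + 2`.
    edge-bound : order * order ≤ 81 * (Θ * N * n ^ (3 * N + 5))
    edge-bound = begin
      order * order                                ≤⟨ *-mono-≤ order≤9B order≤9B ⟩
      (9 * B) * (9 * B)                            ≡⟨ regroup N (n * K) ⟩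
      81 * (N * (N * (n ^ (1 + N) * n ^ (1 + N))))
        ≤⟨ *-monoʳ-≤ 81 (*-mono-≤ (m≤n*m N Θ) (*-monoˡ-≤ _ (k≤n^k (1 + n′) N))) ⟩
      81 * (Θ * N * (n ^ N * (n ^ (1 + N) * n ^ (1 + N))))
        ≡⟨ cong (λ x → 81 * (Θ * N * (n ^ N * x))) (^-distribˡ-+-* n (1 + N) (1 + N)) ⟨
      81 * (Θ * N * (n ^ N * n ^ (1 + N + (1 + N))))
        ≡⟨ cong (λ x → 81 * (Θ * N * x)) (^-distribˡ-+-* n N (1 + N + (1 + N))) ⟨
      81 * (Θ * N * n ^ (N + (1 + N + (1 + N))))
        ≤⟨ *-monoʳ-≤ 81 (*-monoʳ-≤ (Θ * N) (^-monoʳ-≤ n exponent)) ⟩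
      81 * (Θ * N * n ^ (3 * N + 5))               ∎
      where
      regroup : ∀ N L → (9 * (N * L)) * (9 * (N * L)) ≡ 81 * (N * (N * (L * L)))
      regroup = solve-∀

      split : ∀ N → 3 * N + 5 ≡ (N + (1 + N + (1 + N))) + 3
      split = solve-∀

      exponent : N + (1 + N + (1 + N)) ≤ 3 * N + 5
      exponent = subst (N + (1 + N + (1 + N)) ≤_) (sym (split N)) (m≤m+n _ 3)

theorem1 : Σ ℕ λ cV → Σ ℕ λ cE →
    (p q m n : ℕ) → 1 ≤ p → 1 ≤ q → 1 < m → (n≥ : m ⊔ 3 ≤ n) →
    (φ : PartialFunction m p q) → ∃ (_∈Dom φ) →
    Σ Graph λ G → Σ (Terminals G p q n) λ T →
    Simulates T (m⊔n≤o⇒m≤o m 3 n≥) φ ×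
    ((s₀ : Fin m) (φ̃ : Vec (Fin m) (p + q) ⤖ Vec (Fin m) (p + q)) →
    IsInvertibleExtension φ s₀ φ̃ →
    (τs : List (Transposition (Vec (Fin m) (p + q)))) →
    _IsPresentationOf_ (≡-dec _≟_) τs φ̃ →
    1 ≤ length τs →
    Graph.order G ≤ cV * (length τs * (p + q) * n ^ (2 * (p + q) + 4)) ×
    Graph.size G ≤ cE * (length τs * (p + q) * n ^ (3 * (p + q) + 5)))
theorem1 = 9 , 81 , λ where
  p q m 0 _ _ _ n≥ → contradiction (m⊔n≤o⇒n≤o m 3 n≥) λ ()
  p q m 1 _ _ _ n≥ → contradiction (m⊔n≤o⇒n≤o m 3 n≥) λ { (s≤s ()) }
  p q m 2 _ _ _ n≥ → contradiction (m⊔n≤o⇒n≤o m 3 n≥) λ { (s≤s (s≤s ())) }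
  -- Writing the number of colors as `3 + n′` makes 0, 1, 2 available as patterns; `1 ≤ p` and
  -- `1 ≤ q` supply `2 ≤ p + q` for the bounds.
  p q m (suc (suc (suc n′))) 1≤p 1≤q _ n≥ φ dom →
    let module S = Simulator p q m n′ (m⊔n≤o⇒m≤o m 3 n≥) φ dom
        module B = Bounds n′ (p + q) (+-mono-≤ 1≤p 1≤q)
    in S.graph , S.terminals , S.simulates , λ _ _ _ _ _ 1≤Θ →
         B.vertex-bound 1≤Θ B.order-bound ,
         ≤-trans (size≤order² S.graph) (B.edge-bound 1≤Θ B.order-bound)
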